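{- Let $G$ and $G+x$ be two connected graphs and let $\sigma$ be an LBFS ordering of $G+x$ in which $x$ appears last. If $G$ is prime and $x$ has a twin $y$, then $y$ is either universal in $G$ or is the penultimate vertex in $\sigma$.
   Context: Graphs are simple and undirected. $G+x$ is obtained from $G$ by adding a new vertex $x$ adjacent to a set $N(x)\subseteq V(G)$. For a vertex set $S$, $N(S)=(\bigcup_{y\in S}N(y))\setminus S$. A split of a connected graph is a bipartition $(A,B)$ of its vertex set with $|A|,|B|>1$ such that every vertex of $N(B)$ is adjacent to every vertex of $N(A)$. A graph not containing a split is called prime. Two vertices $x$ and $y$ are twins if $N(x)\setminus\{y\}=N(y)\setminus\{x\}$ (here neighbourhoods are taken in $G+x$). A vertex is universal in a graph if it is adjacent to every other vertex of the graph. The penultimate vertex of an ordering is the one appearing immediately before the last one. An LBFS (Lexicographic Breadth-First Search) ordering of an $n$-vertex graph is any ordering produced as follows: all vertices start with an empty label; for $i=1,\dots,n$, pick any unnumbered vertex $v$ with lexicographically largest label, assign it the number $i$, and append $n-i+1$ to the label of every unnumbered neighbour of $v$.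
   Formalization: It is additionally assumed that G is not the path on three vertices: for G = a-b-c with N(x) = {b}, G is vacuously prime and b, a, c, x is an LBFS ordering, but the twin a is neither universal in G nor penultimate. -}

module Defs where

open import Data.Bool.Base using (if_then_else_)
open import Data.Fin.Base using (Fin; zero; suc)
open import Data.Fin.Subset
  using (Subset; outside; _∈_; _∉_; _∩_; _∪_; _-_; ⊤; ∣_∣; Empty)
open import Data.Fin.Subset.Properties using (_∈?_)
open import Data.List.Base using (List; []; _∷_; _++_; _∷ʳ_)
open import Data.List.Relation.Binary.Lex.Strict using (Lex-≤)
open import Data.Nat.Base using (ℕ; suc; _+_; _∸_; _<_)
open import Data.Product.Base using (∃; ∃₂; _×_)
open import Data.Vec.Base using (_∷_; lookup; there)
open import Data.Vec.Properties using (lookup⇒[]=; []=⇒lookup)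
open import Relation.Binary.Construct.Closure.ReflexiveTransitive using (Star)
open import Relation.Binary.PropositionalEquality using (_≡_; _≢_)
open import Relation.Nullary using (¬_; does)

record Graph (n : ℕ) : Set where
  field
    N      : Fin n → Subset n
    sym    : ∀ {u v} → v ∈ N u → u ∈ N v
    irrefl : ∀ {v} → v ∉ N v

open Graph public using (N)

-- G ⊕ S is the graph G + x with N(x) = S.  The new vertex x is zero, and a
-- vertex v of G becomes suc v.
_⊕_ : ∀ {n} → Graph n → Subset n → Graph (suc n)
_⊕_ {n} G S = record { N = N⁺ ; sym = λ {u} {v} → sym⁺ u v ; irrefl = λ {v} → irrefl⁺ v }
  where
  N⁺ : Fin (suc n) → Subset (suc n)
  N⁺ zero    = outside ∷ S
  N⁺ (suc v) = lookup S v ∷ N G v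

  sym⁺ : ∀ u v → v ∈ N⁺ u → u ∈ N⁺ v
  sym⁺ zero    (suc v) (there v∈S) = lookup⇒[]= zero (N⁺ (suc v)) ([]=⇒lookup v∈S)
  sym⁺ (suc u) zero    p           = there (lookup⇒[]= u S ([]=⇒lookup p))
  sym⁺ (suc u) (suc v) (there p)   = there (Graph.sym G p)

  irrefl⁺ : ∀ v → v ∉ N⁺ v
  irrefl⁺ (suc v) (there p) = Graph.irrefl G p

newVertex : ∀ {n} → Fin (suc n)
newVertex = zero

Connected : ∀ {n} → Graph n → Set
Connected G = ∀ u v → Star (λ a b → b ∈ N G a) u v

Universal : ∀ {n} → Graph n → Fin n → Set
Universal G y = ∀ v → v ≢ y → v ∈ N G y

Twins : ∀ {n} → Graph n → Fin n → Fin n → Set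
Twins G x y = x ≢ y × N G x - y ≡ N G y - x

-- v ∈ N(S), where N(S) = (⋃_{y ∈ S} N(y)) \ S.
InNbhd : ∀ {n} → Graph n → Subset n → Fin n → Set
InNbhd G S v = v ∉ S × ∃ λ y → y ∈ S × v ∈ N G y

record IsSplit {n} (G : Graph n) (A B : Subset n) : Set where
  field
    cover    : A ∪ B ≡ ⊤
    disjoint : Empty (A ∩ B)
    1<∣A∣    : 1 < ∣ A ∣
    1<∣B∣    : 1 < ∣ B ∣
    complete : ∀ {a b} → InNbhd G B a → InNbhd G A b → b ∈ N G a

Prime : ∀ {n} → Graph n → Set
Prime G = ¬ ∃₂ (IsSplit G)

-- G is a path a - b - c.  It has too few vertices to have a split, so it is
-- vacuously Prime.  It must be set aside as a degenerate case: adding a leaf x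
-- at b gives a star with LBFS ordering b, a, c, x, in which the twin a of x is
-- neither universal in G nor penultimate.
IsP₃ : ∀ {n} → Graph n → Set
IsP₃ {n} G = n ≡ 3 × ∃ λ a → ∃ λ b → ∃ λ c →
  a ≢ c × b ∈ N G a × c ∈ N G b × c ∉ N G a

Labelling : ℕ → Set
Labelling n = Fin n → List ℕ

_≤ₗₑₓ_ : List ℕ → List ℕ → Set
_≤ₗₑₓ_ = Lex-≤ _≡_ _<_

append : ∀ {n} → Subset n → ℕ → Labelling n → Labelling n
append T k ℓ u = if does (u ∈? T) then ℓ u ∷ʳ k else ℓ u

-- LBFSFrom G i U ℓ σ: when number i is about to be assigned, with U the set of
-- unnumbered vertices and ℓ the current labels, the search can number the
-- vertices of U in the order σ.
data LBFSFrom {n} (G : Graph n) :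
       ℕ → Subset n → Labelling n → List (Fin n) → Set where
  done : ∀ {i U ℓ} → Empty U → LBFSFrom G i U ℓ []
  pick : ∀ {i U ℓ σ} v → v ∈ U → (∀ u → u ∈ U → ℓ u ≤ₗₑₓ ℓ v) →
         LBFSFrom G (suc i) (U - v) (append (N G v ∩ (U - v)) (n ∸ i + 1) ℓ) σ →
         LBFSFrom G i U ℓ (v ∷ σ)

IsLBFS : ∀ {n} → Graph n → List (Fin n) → Set
IsLBFS G σ = LBFSFrom G 1 ⊤ (λ _ → []) σ

Last : ∀ {n} → List (Fin n) → Fin n → Set
Last σ v = ∃ λ τ → σ ≡ τ ∷ʳ v

Penultimate : ∀ {n} → List (Fin n) → Fin n → Set
Penultimate σ v = ∃₂ λ τ z → σ ≡ τ ++ v ∷ z ∷ []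

{-# OPTIONS --safe #-}

-- An LBFS ordering satisfies the four-point condition: if a, b, c appear in this
-- order, a ~ c and a ≁ b, then some d before a has d ~ b and d ≁ c.
-- Let y be a non-penultimate twin of the last vertex x.  A descent with the
-- four-point condition shows that the vertices from y onwards, x excluded, form
-- a module of G, and so do those among them that are not neighbours of y.  In a
-- prime connected graph a module with two vertices misses at most one vertex,
-- which is then universal.  So if y is not universal, it has degree one, next
-- to a universal vertex, and this leaves a split unless G is a path on three
-- vertices.
module Submission where

open import Defs
open import Data.Bool.Base using (true; false)
open import Data.Empty using (⊥; ⊥-elim)
open import Data.Nat.Base as ℕ using (ℕ; suc; _+_; _∸_; _<_; _≤_; _>_; s≤s; z≤n)
open import Data.Nat.Induction using (<-rec)
open import Data.Nat.Properties
open import Data.Fin.Base using (Fin; zero; suc)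
open import Data.Fin.Properties using (injective⇒≤)
  renaming (_≟_ to _≟ᶠ_; suc-injective to sucᶠ-injective)
open import Data.Fin.Subset using (Subset; _∈_; _∉_; _∩_; _-_; ⊤; ∁; ∣_∣)
open import Data.Fin.Subset.Properties
  using (_∈?_; p─q⊆p; x∈p∧x≢y⇒x∈p-y; x∈p⇒∣p-x∣<∣p∣; ∣p∣≤n; x∈p∩q⁺; x∈p∩q⁻; ∈⊤;
         p∪∁p≡⊤; x∈∁p⇒x∉p; x∉p⇒x∈∁p)
open import Data.List.Base using (List; []; _∷_; _∷ʳ_)
open import Data.List.Membership.Propositional using () renaming (_∈_ to _∈ˡ_; _∉_ to _∉ˡ_)
open import Data.List.Membership.Propositional.Properties using (∈-++⁺ˡ; ∈-++⁺ʳ; ∈-++⁻)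
open import Data.List.Relation.Binary.Lex.Strict using (this; next)
open import Data.List.Relation.Unary.All as All using (All; []; _∷_)
import Data.List.Relation.Unary.All.Properties as All
open import Data.List.Relation.Unary.AllPairs using (AllPairs; []; _∷_)
import Data.List.Relation.Unary.AllPairs.Properties as AllPairs
open import Data.List.Relation.Unary.Any using (here; there)
open import Data.List.Relation.Unary.Unique.Propositional using (Unique)
open import Data.Product.Base using (∃; _×_; _,_; proj₁; proj₂)
open import Data.Sum.Base using (_⊎_; inj₁; inj₂)
open import Data.Vec.Base using (tabulate; there) renaming (_∷_ to _∷ᵛ_)
open import Data.Vec.Properties using (lookup⇒[]=; []=⇒lookup; lookup∘tabulate)
open import Function.Base using (_∘_)
open import Relation.Binary.Construct.Closure.ReflexiveTransitive using (ε; _◅_)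
open import Relation.Binary.Definitions using (tri<; tri≈; tri>)
open import Relation.Binary.PropositionalEquality
open import Relation.Nullary using (¬_; Dec; yes; no; does; contradiction)
open import Relation.Nullary.Decidable using (decidable-stable; _×-dec_; ¬?; _⊎-dec_)
open import Relation.Unary using (Pred; Decidable)

-- Finite subsets

x∉p-x : ∀ {n} (p : Subset n) x → x ∉ p - x
x∉p-x (_ ∷ᵛ p) zero    ()
x∉p-x (_ ∷ᵛ p) (suc x) (there x∈) = x∉p-x p x x∈

1<∣p∣ : ∀ {n} {p : Subset n} {a b} → a ∈ p → b ∈ p → a ≢ b → 1 < ∣ p ∣
1<∣p∣ {p = p} {a} {b} a∈p b∈p a≢b =
  ≤-trans (s≤s (≤-trans (s≤s z≤n) (x∈p⇒∣p-x∣<∣p∣ b∈p-a))) (x∈p⇒∣p-x∣<∣p∣ a∈p)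
  where
  b∈p-a : b ∈ p - a
  b∈p-a = x∈p∧x≢y⇒x∈p-y b∈p (a≢b ∘ sym)

module _ {n ℓ} {P : Pred (Fin n) ℓ} (P? : Decidable P) where

  collect : Subset n
  collect = tabulate (does ∘ P?)

  ∈-collect⁺ : ∀ {v} → P v → v ∈ collect
  ∈-collect⁺ {v} Pv = lookup⇒[]= v collect (trans (lookup∘tabulate _ v) (lem (P? v)))
    where
    lem : (d : Dec (P v)) → does d ≡ true
    lem (yes _) = refl
    lem (no ¬p) = contradiction Pv ¬p

  ∈-collect⁻ : ∀ {v} → v ∈ collect → P v
  ∈-collect⁻ {v} v∈ = lem (P? v) (trans (sym (lookup∘tabulate _ v)) ([]=⇒lookup v∈))
    where
    lem : (d : Dec (P v)) → does d ≡ true → P v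
    lem (yes p) _ = p

-- Positions in a list

-- An absent vertex gets the length of the list, so injectivity asks for membership.
pos : ∀ {n} → List (Fin n) → Fin n → ℕ
pos []      u = 0
pos (v ∷ σ) u with u ≟ᶠ v
... | yes _ = 0
... | no  _ = suc (pos σ u)

pos-here : ∀ {n} (σ : List (Fin n)) v → pos (v ∷ σ) v ≡ 0
pos-here σ v with v ≟ᶠ v
... | yes _  = refl
... | no v≢v = contradiction refl v≢v

pos-there : ∀ {n} (σ : List (Fin n)) {u v} → u ≢ v → pos (v ∷ σ) u ≡ suc (pos σ u)
pos-there σ {u} {v} u≢v with u ≟ᶠ v
... | yes u≡v = contradiction u≡v u≢v
... | no  _   = refl

pos-injective : ∀ {n} {σ : List (Fin n)} {u v} → u ∈ˡ σ → v ∈ˡ σ → pos σ u ≡ pos σ v → u ≡ v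
pos-injective {σ = w ∷ σ} {u} {v} u∈ v∈ eq with u ≟ᶠ w | v ≟ᶠ w | u∈ | v∈
... | yes refl | yes refl | _        | _        = refl
... | no  u≢w  | no  v≢w  | here u≡w | _        = contradiction u≡w u≢w
... | no  u≢w  | no  v≢w  | there _  | here v≡w = contradiction v≡w v≢w
... | no  u≢w  | no  v≢w  | there p  | there q  = pos-injective p q (suc-injective eq)

pos<pos-last : ∀ {n} (τ : List (Fin n)) {x u} → Unique (τ ∷ʳ x) → u ∈ˡ τ → pos (τ ∷ʳ x) u < pos (τ ∷ʳ x) x
pos<pos-last (v ∷ τ) {x} {u} (v# ∷ uniq) u∈ with u ≟ᶠ v | x ≟ᶠ v | u∈
... | _       | yes refl | _         = contradiction refl (All.lookup v# (∈-++⁺ʳ τ (here refl)))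
... | yes _   | no _     | _         = s≤s z≤n
... | no u≢v  | no _     | here u≡v  = contradiction u≡v u≢v
... | no _    | no _     | there u∈τ = s≤s (pos<pos-last τ uniq u∈τ)

before-last : ∀ {n} (τ : List (Fin n)) {x u} → u ∈ˡ τ ∷ʳ x → u ≢ x → u ∈ˡ τ
before-last τ u∈ u≢x with ∈-++⁻ τ u∈
... | inj₁ u∈τ        = u∈τ
... | inj₂ (here u≡x) = contradiction u≡x u≢x

-- In the second case `z` is what gives the module of vertices from `y` onwards a second element.
penultimate⊎followed : ∀ {n} (τ : List (Fin n)) {x y} → Unique (τ ∷ʳ x) → y ∈ˡ τ →
  Penultimate (τ ∷ʳ x) y ⊎ ∃ λ z → z ∈ˡ τ × pos (τ ∷ʳ x) y < pos (τ ∷ʳ x) z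
penultimate⊎followed (v ∷ [])    {x} uniq (here refl) = inj₁ ([] , x , refl)
penultimate⊎followed (v ∷ w ∷ τ) {x} ((v≢w ∷ _) ∷ _) (here refl) =
  inj₂ (w , there (here refl) , subst₂ _<_ (sym (pos-here _ v)) (sym (pos-there _ (v≢w ∘ sym))) (s≤s z≤n))
penultimate⊎followed (v ∷ τ) {x} (v# ∷ uniq) (there y∈τ) with penultimate⊎followed τ uniq y∈τ
... | inj₁ (ρ , z , eq)   = inj₁ (v ∷ ρ , z , cong (v ∷_) eq)
... | inj₂ (z , z∈τ , lt) = inj₂ (z , there z∈τ ,
  subst₂ _<_ (sym (pos-there _ (≢v y∈τ))) (sym (pos-there _ (≢v z∈τ))) (s≤s lt))
  where
  ≢v : ∀ {u} → u ∈ˡ τ → u ≢ v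
  ≢v u∈τ refl = All.lookup v# (∈-++⁺ˡ u∈τ) refl

-- LBFS and the four-point condition

-- Descending lists are compared by the largest element of their symmetric difference. At the first
-- disagreement the entry of `ys` exceeds all that is left of `xs`, and `k` is among what is left
-- because the common prefix lies in `ys`.
≤ₗₑₓ⇒larger : ∀ {xs ys k} → AllPairs _>_ xs → AllPairs _>_ ys → xs ≤ₗₑₓ ys →
  k ∈ˡ xs → k ∉ˡ ys → ∃ λ e → k < e × e ∈ˡ ys × e ∉ˡ xs
≤ₗₑₓ⇒larger {xs = x ∷ xs} {y ∷ ys} {k} (x> ∷ _) _ (this x<y) k∈ _ =
  y , ≤-<-trans (below k∈) x<y , here refl , λ y∈ → <⇒≱ x<y (below y∈)
  where
  below : ∀ {e} → e ∈ˡ x ∷ xs → e ≤ x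
  below (here refl) = ≤-refl
  below (there e∈)  = <⇒≤ (All.lookup x> e∈)
≤ₗₑₓ⇒larger _ _ (next refl _) (here refl) k∉ = contradiction (here refl) k∉
≤ₗₑₓ⇒larger (_ ∷ dx) (y> ∷ dy) (next refl le) (there k∈) k∉
  with ≤ₗₑₓ⇒larger dx dy le k∈ (k∉ ∘ there)
... | e , k<e , e∈ , e∉ = e , k<e , there e∈ ,
  λ { (here refl) → <-irrefl refl (All.lookup y> e∈) ; (there e∈xs) → e∉ e∈xs }

FourPoint : ∀ {n} → Graph n → (Fin n → ℕ) → Set
FourPoint G q = ∀ {a b c} → q a < q b → q b < q c → c ∈ N G a → b ∉ N G a →
  ∃ λ d → q d < q a × b ∈ N G d × c ∉ N G d

module _ {n} {G : Graph n} where

  lbfs-visits : ∀ {i U ℓ σ} → LBFSFrom G i U ℓ σ → ∀ {u} → u ∈ U → u ∈ˡ σ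
  lbfs-visits (done empty)        u∈U = contradiction (_ , u∈U) empty
  lbfs-visits (pick v _ _ r) {u} u∈U with u ≟ᶠ v
  ... | yes u≡v = here u≡v
  ... | no  u≢v = there (lbfs-visits r (x∈p∧x≢y⇒x∈p-y u∈U u≢v))

  lbfs-unnumbered : ∀ {i U ℓ σ} → LBFSFrom G i U ℓ σ → ∀ {u} → u ∈ˡ σ → u ∈ U
  lbfs-unnumbered (pick v v∈U _ r) (here refl) = v∈U
  lbfs-unnumbered (pick v v∈U _ r) (there u∈σ) = p─q⊆p _ _ (lbfs-unnumbered r u∈σ)

  lbfs-unique : ∀ {i U ℓ σ} → LBFSFrom G i U ℓ σ → Unique σ
  lbfs-unique (done _) = []
  lbfs-unique (pick {U = U} v _ _ r) =
    All.tabulate (λ u∈σ v≡u → x∉p-x U v (subst (_∈ U - v) (sym v≡u) (lbfs-unnumbered r u∈σ)))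
    ∷ lbfs-unique r

module _ {n} (G : Graph n) (q : Fin n → ℕ) (q-injective : ∀ {u v} → q u ≡ q v → u ≡ v) where

  -- A vertex a numbered at time q a appends n ∸ q a + 1.  `bounded` says that every
  -- label entry exceeds n ∸ i + 1, the next one to be appended, without subtraction:
  -- the truncation at i = n + 1 would make that inequality fail.
  record Invariant (i : ℕ) (U : Subset n) (ℓ : Labelling n) (σ : List (Fin n)) : Set where
    field
      descending : ∀ u → AllPairs _>_ (ℓ u)
      bounded    : ∀ u → All (λ e → suc n < e + i) (ℓ u)
      -- Together with `complete`: the label of an unnumbered vertex encodes exactly its neighbours
      -- numbered so far.
      sound      : ∀ {u e} → u ∈ U → e ∈ˡ ℓ u → ∃ λ a → q a < i × e ≡ n ∸ q a + 1 × u ∈ N G a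
      complete   : ∀ {u a} → u ∈ U → q a < i → u ∈ N G a → (n ∸ q a + 1) ∈ˡ ℓ u
      -- `q` is the final numbering, fixed before the run; this ties it to the order still to come.
      upcoming   : ∀ {u} → u ∈ U → q u ≡ i + pos σ u
      -- Gives `i ≤ n` as long as a vertex is left, so `n ∸ i` is not truncated.
      budget     : i + ∣ U ∣ ≤ suc n

  module _ {i U ℓ v σ} (v∈U : v ∈ U) (I : Invariant i U ℓ (v ∷ σ)) where
    open Invariant I

    q-head : q v ≡ i
    q-head = trans (upcoming v∈U) (trans (cong (i +_) (pos-here σ v)) (+-identityʳ i))

    within-budget : i ≤ n
    within-budget = ℕ.s≤s⁻¹ (≤-trans (subst (_≤ i + ∣ U ∣) (+-comm i 1)
      (+-monoʳ-≤ i (≤-trans (s≤s z≤n) (x∈p⇒∣p-x∣<∣p∣ v∈U)))) budget)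

    number : ℕ
    number = n ∸ i + 1

    number+i : number + i ≡ suc n
    number+i = begin
      n ∸ i + 1 + i ≡⟨ cong (_+ i) (+-comm (n ∸ i) 1) ⟩
      suc (n ∸ i + i) ≡⟨ cong suc (m∸n+n≡m within-budget) ⟩
      suc n ∎
      where open ≡-Reasoning

    ℓ′ : Labelling n
    ℓ′ = append (N G v ∩ (U - v)) number ℓ

    invariant-step : Invariant (suc i) (U - v) ℓ′ σ
    invariant-step = record
      { descending = descending′
      ; bounded    = bounded′
      ; sound      = sound′
      ; complete   = complete′
      ; upcoming   = λ {u} u∈ → begin
          q u                ≡⟨ upcoming (⊆U u∈) ⟩
          i + pos (v ∷ σ) u  ≡⟨ cong (i +_) (pos-there σ (λ { refl → x∉p-x U v u∈ })) ⟩
          i + suc (pos σ u)  ≡⟨ +-suc i _ ⟩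
          suc i + pos σ u    ∎
      ; budget     = ≤-trans (≤-reflexive (sym (+-suc i _)))
                       (≤-trans (+-monoʳ-≤ i (x∈p⇒∣p-x∣<∣p∣ v∈U)) budget)
      }
      where
      open ≡-Reasoning

      ⊆U : ∀ {u} → u ∈ U - v → u ∈ U
      ⊆U = p─q⊆p U _

      descending′ : ∀ u → AllPairs _>_ (ℓ′ u)
      descending′ u with does (u ∈? (N G v ∩ (U - v)))
      ... | false = descending u
      -- The new entry is below all older ones: `bounded` compares them after adding `i` to both
      -- sides.
      ... | true  = AllPairs.++⁺ (descending u) ([] ∷ [])
        (All.map (λ {e} n<e → +-cancelʳ-< i number e (subst (_< e + i) (sym number+i) n<e) ∷ []) (bounded u))

      weaken : ∀ {e} → suc n < e + i → suc n < e + suc i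
      weaken {e} lt = ≤-trans lt (+-monoʳ-≤ e (n≤1+n i))

      bounded′ : ∀ u → All (λ e → suc n < e + suc i) (ℓ′ u)
      bounded′ u with does (u ∈? (N G v ∩ (U - v)))
      ... | false = All.map weaken (bounded u)
      ... | true  = All.∷ʳ⁺ (All.map weaken (bounded u))
        (≤-reflexive (trans (cong suc (sym number+i)) (sym (+-suc number i))))

      weakenˢ : ∀ {u e} → (∃ λ a → q a < i × e ≡ n ∸ q a + 1 × u ∈ N G a) →
                ∃ λ a → q a < suc i × e ≡ n ∸ q a + 1 × u ∈ N G a
      weakenˢ (a , lt , rest) = a , m<n⇒m<1+n lt , rest

      sound′ : ∀ {u e} → u ∈ U - v → e ∈ˡ ℓ′ u → ∃ λ a → q a < suc i × e ≡ n ∸ q a + 1 × u ∈ N G a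
      sound′ {u} u∈ e∈ with u ∈? (N G v ∩ (U - v))
      ... | no _ = weakenˢ (sound (⊆U u∈) e∈)
      ... | yes u∈∩ with ∈-++⁻ (ℓ u) e∈
      ...   | inj₁ e∈ℓ         = weakenˢ (sound (⊆U u∈) e∈ℓ)
      ...   | inj₂ (here refl) = v , ≤-reflexive (cong suc q-head) ,
        cong (λ j → n ∸ j + 1) (sym q-head) , proj₁ (x∈p∩q⁻ (N G v) (U - v) u∈∩)

      complete′ : ∀ {u a} → u ∈ U - v → q a < suc i → u ∈ N G a → (n ∸ q a + 1) ∈ˡ ℓ′ u
      complete′ {u} {a} u∈ qa≤i u∈Na with m≤n⇒m<n∨m≡n (ℕ.s≤s⁻¹ qa≤i) | u ∈? (N G v ∩ (U - v))
      ... | inj₁ qa<i | no _   = complete (⊆U u∈) qa<i u∈Na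
      ... | inj₁ qa<i | yes _  = ∈-++⁺ˡ (complete (⊆U u∈) qa<i u∈Na)
      ... | inj₂ qa≡i | yes _  = ∈-++⁺ʳ (ℓ u) (here (cong (λ j → n ∸ j + 1) qa≡i))
      ... | inj₂ qa≡i | no u∉∩ = contradiction (x∈p∩q⁺ (subst (λ w → u ∈ N G w) a≡v u∈Na , u∈)) u∉∩
        where
        a≡v : a ≡ v
        a≡v = q-injective (trans qa≡i (sym q-head))

    -- `v` was preferred to `c` although only the label of `c` has the entry of `a`. So the label of
    -- `v` has a larger entry that the label of `c` lacks, and larger entries come from earlier
    -- vertices.
    head-fourPoint : (∀ u → u ∈ U → ℓ u ≤ₗₑₓ ℓ v) → ∀ {a c} → q a < q v → c ∈ U →
      c ∈ N G a → v ∉ N G a → ∃ λ d → q d < q a × v ∈ N G d × c ∉ N G d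
    head-fourPoint maximal {a} {c} qa<qv c∈U c∈Na v∉Na
      with ≤ₗₑₓ⇒larger (descending c) (descending v) (maximal c c∈U)
             (complete c∈U qa<i c∈Na) k∉ℓv
      where
      qa<i : q a < i
      qa<i = subst (q a <_) q-head qa<qv
      k∉ℓv : (n ∸ q a + 1) ∉ˡ ℓ v
      k∉ℓv k∈ℓv with sound v∈U k∈ℓv
      ... | a′ , qa′<i , eq , v∈Na′ = v∉Na (subst (λ w → v ∈ N G w) (sym a≡a′) v∈Na′)
        where
        a≡a′ : a ≡ a′
        -- Both numbers are at most `n`, so equal entries come from equal numbers.
        a≡a′ = q-injective (∸-cancelˡ-≡ (<⇒≤ (<-≤-trans qa<i within-budget))
          (<⇒≤ (<-≤-trans qa′<i within-budget)) (+-cancelʳ-≡ 1 _ _ eq))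
    ... | e , k<e , e∈ℓv , e∉ℓc with sound v∈U e∈ℓv
    ...   | d , qd<i , refl , v∈Nd =
      d , ∸-cancelʳ-< (+-cancelʳ-< 1 _ _ k<e) , v∈Nd , λ c∈Nd → e∉ℓc (complete c∈U qd<i c∈Nd)

  -- The run is followed until `b` is picked; `c` is later in `q`, so it is still unnumbered and
  -- competes with `b`.
  lbfsFrom-fourPoint : ∀ {i U ℓ σ} → LBFSFrom G i U ℓ σ → Invariant i U ℓ σ →
    ∀ {a b c} → b ∈ U → c ∈ U → q a < q b → q b < q c → c ∈ N G a → b ∉ N G a →
    ∃ λ d → q d < q a × b ∈ N G d × c ∉ N G d
  lbfsFrom-fourPoint (done empty) _ b∈U = contradiction (_ , b∈U) empty
  lbfsFrom-fourPoint (pick {i} v v∈U maximal r) I {b = b} {c} b∈U c∈U qa<qb qb<qc c∈Na b∉Na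
    with b ≟ᶠ v
  ... | yes refl = head-fourPoint v∈U I maximal qa<qb c∈U c∈Na b∉Na
  ... | no  b≢v  = lbfsFrom-fourPoint r (invariant-step v∈U I)
    (x∈p∧x≢y⇒x∈p-y b∈U b≢v) (x∈p∧x≢y⇒x∈p-y c∈U c≢v) qa<qb qb<qc c∈Na b∉Na
    where
    c≢v : c ≢ v
    c≢v refl = <⇒≱ qb<qc (≤-trans (≤-reflexive (q-head v∈U I))
      (≤-trans (m≤m+n i _) (≤-reflexive (sym (Invariant.upcoming I b∈U)))))

lbfs-pos-injective : ∀ {n} {G : Graph n} {σ} → IsLBFS G σ → ∀ {u v} → pos σ u ≡ pos σ v → u ≡ v
lbfs-pos-injective r = pos-injective (lbfs-visits r ∈⊤) (lbfs-visits r ∈⊤)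

lbfs-fourPoint : ∀ {n} {G : Graph n} {σ} → IsLBFS G σ → FourPoint G (pos σ)
lbfs-fourPoint {n} {G} {σ} r a<b b<c c∈Na b∉Na
  -- Numbers start at 1 and positions at 0, hence `suc`.
  with lbfsFrom-fourPoint G (suc ∘ pos σ) (lbfs-pos-injective r ∘ suc-injective) r
    record
      { descending = λ _ → []
      ; bounded    = λ _ → []
      ; sound      = λ _ ()
      ; complete   = λ { _ (s≤s ()) }
      ; upcoming   = λ _ → refl
      ; budget     = s≤s (∣p∣≤n ⊤)
      } ∈⊤ ∈⊤ (s≤s a<b) (s≤s b<c) c∈Na b∉Na
... | d , s≤s d<a , rest = d , d<a , rest

-- Twins of the last vertex

module LastTwin {n} (H : Graph n) (q : Fin n → ℕ)
  (injective : ∀ {u v} → q u ≡ q v → u ≡ v) (fourPoint : FourPoint H q) {x y : Fin n}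
  (last : ∀ v → v ≢ x → q v < q x) (twins : Twins H x y) where

  Ny⇒Nx : ∀ {v} → v ≢ x → v ∈ N H y → v ∈ N H x
  Ny⇒Nx v≢x v∈Ny = p─q⊆p _ _ (subst (_ ∈_) (sym (proj₂ twins)) (x∈p∧x≢y⇒x∈p-y v∈Ny v≢x))

  y∈⇒x∈ : ∀ {v} → v ≢ x → y ∈ N H v → x ∈ N H v
  y∈⇒x∈ v≢x = Graph.sym H ∘ Ny⇒Nx v≢x ∘ Graph.sym H

  <y⇒≢x : ∀ {v} → q v < q y → v ≢ x
  <y⇒≢x lt refl = <-asym lt (last y (proj₁ twins ∘ sym))

  -- Indexed by the position of `a`, for strong induction on positions.
  Uniform : ℕ → Set
  Uniform k = ∀ a → q a ≡ k → ∀ z → z ≢ x → q a < q y → q y < q z →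
    (z ∈ N H a → y ∈ N H a) × (y ∈ N H a → z ∈ N H a)

  -- Descent: if `a` distinguishes `y` from `z`, the four-point condition yields an earlier vertex
  -- that also does.
  uniform : ∀ k → Uniform k
  uniform = <-rec Uniform step
    where
    step : ∀ k → (∀ {j} → j < k → Uniform j) → Uniform k
    step _ rec a refl z z≢x a<y y<z =
      (λ z∈Na → decidable-stable (y ∈? N H a) λ y∉Na → first z∈Na y∉Na) ,
      (λ y∈Na → decidable-stable (z ∈? N H a) λ z∉Na → second y∈Na z∉Na)
      where
      ih : ∀ {d} → q d < q a → (z ∈ N H d → y ∈ N H d) × (y ∈ N H d → z ∈ N H d)
      ih {d} d<a = rec d<a d refl z z≢x (<-trans d<a a<y) y<z

      first : z ∈ N H a → y ∉ N H a → ⊥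
      first z∈Na y∉Na with fourPoint a<y y<z z∈Na y∉Na
      ... | d , d<a , y∈Nd , z∉Nd = z∉Nd (proj₂ (ih d<a) y∈Nd)

      second : y ∈ N H a → z ∉ N H a → ⊥
      -- The triple is `a`, `z`, `x`: the last vertex `x` stands in for its twin `y`, which comes
      -- too early.
      second y∈Na z∉Na
        with fourPoint (<-trans a<y y<z) (last z z≢x) (y∈⇒x∈ (<y⇒≢x a<y) y∈Na) z∉Na
      ... | d , d<a , z∈Nd , x∉Nd = x∉Nd (y∈⇒x∈ (<y⇒≢x (<-trans d<a a<y)) (proj₁ (ih d<a) z∈Nd))

  module _ {a z} (a<y : q a < q y) (y<z : q y < q z) (z≢x : z ≢ x) where

    before-z⇒y : z ∈ N H a → y ∈ N H a
    before-z⇒y = proj₁ (uniform _ a refl z z≢x a<y y<z)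

    before-y⇒z : y ∈ N H a → z ∈ N H a
    before-y⇒z = proj₂ (uniform _ a refl z z≢x a<y y<z)

  module _ {m} (y<m : q y < q m) (m≢x : m ≢ x) (m∉Ny : m ∉ N H y) where

    -- Otherwise the triple `y`, `m`, `w` gives a vertex before `y` that sees `m` but not `w`,
    -- against `uniform`.
    neighbours-first : ∀ {w} → w ≢ x → w ∈ N H y → ¬ q m < q w
    neighbours-first w≢x w∈Ny m<w with fourPoint y<m m<w w∈Ny m∉Ny
    ... | d , d<y , m∈Nd , w∉Nd =
      w∉Nd (before-y⇒z d<y (<-trans y<m m<w) w≢x (before-z⇒y d<y y<m m≢x m∈Nd))

  -- If `m` precedes `w`, `neighbours-first` applies. Otherwise `w`, `m`, `x` is a four-point
  -- triple, since `x` shares the neighbour `w` of its twin.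
  after-complete : ∀ {m w} → q y < q m → m ≢ x → m ∉ N H y →
    q y < q w → w ≢ x → w ∈ N H y → m ∈ N H w
  after-complete {m} {w} y<m m≢x m∉Ny y<w w≢x w∈Ny =
    decidable-stable (m ∈? N H w) impossible
    where
    impossible : ¬ m ∉ N H w
    impossible m∉Nw with <-cmp (q m) (q w)
    ... | tri< m<w _ _ = neighbours-first y<m m≢x m∉Ny w≢x w∈Ny m<w
    ... | tri≈ _ m≡w _ = m∉Ny (subst (_∈ N H y) (sym (injective m≡w)) w∈Ny)
    ... | tri> _ _ w<m with fourPoint w<m (last m m≢x) (Graph.sym H (Ny⇒Nx w≢x w∈Ny)) m∉Nw
    ...   | d , d<w , m∈Nd , x∉Nd with <-cmp (q d) (q y)
    ...     | tri< d<y _ _ = x∉Nd (y∈⇒x∈ (<y⇒≢x d<y) (before-z⇒y d<y y<m m≢x m∈Nd))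
    ...     | tri≈ _ d≡y _ = m∉Ny (subst (λ u → m ∈ N H u) (injective d≡y) m∈Nd)
    -- `d` misses `x`, hence misses `y`, yet precedes the neighbour `w` of `y`.
    ...     | tri> _ _ y<d = neighbours-first y<d d≢x (λ d∈Ny → x∉Nd (Graph.sym H (Ny⇒Nx d≢x d∈Ny))) w≢x w∈Ny d<w
      where
      d≢x : d ≢ x
      d≢x refl = <-asym (<-trans d<w w<m) (last m m≢x)

-- Modules of prime graphs

-- One implication suffices, as `a` and `a′` can be exchanged.
IsModule : ∀ {n} → Graph n → Subset n → Set
IsModule G A = ∀ {a a′ b} → a ∈ A → a′ ∈ A → b ∉ A → a ∈ N G b → a′ ∈ N G b

three-vertices : ∀ {n} {u v w : Fin n} → u ≢ v → u ≢ w → v ≢ w →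
  (∀ t → t ≡ u ⊎ t ≡ v ⊎ t ≡ w) → n ≡ 3
three-vertices {n} {u} {v} {w} u≢v u≢w v≢w all =
  ≤-antisym (injective⇒≤ (λ {s} {t} → index-injective s t)) (injective⇒≤ (λ {i} {j} → vertex-injective i j))
  where
  code : ∀ {t} → t ≡ u ⊎ t ≡ v ⊎ t ≡ w → Fin 3
  code (inj₁ _)        = zero
  code (inj₂ (inj₁ _)) = suc zero
  code (inj₂ (inj₂ _)) = suc (suc zero)

  vertex : Fin 3 → Fin n
  vertex zero             = u
  vertex (suc zero)       = v
  vertex (suc (suc zero)) = w

  vertex-code : ∀ {t} (d : t ≡ u ⊎ t ≡ v ⊎ t ≡ w) → vertex (code d) ≡ t
  vertex-code (inj₁ refl)        = refl
  vertex-code (inj₂ (inj₁ refl)) = refl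
  vertex-code (inj₂ (inj₂ refl)) = refl

  index-injective : ∀ s t → code (all s) ≡ code (all t) → s ≡ t
  index-injective s t eq =
    trans (sym (vertex-code (all s))) (trans (cong vertex eq) (vertex-code (all t)))

  vertex-injective : ∀ i j → vertex i ≡ vertex j → i ≡ j
  vertex-injective zero             zero             _  = refl
  vertex-injective zero             (suc zero)       eq = contradiction eq u≢v
  vertex-injective zero             (suc (suc zero)) eq = contradiction eq u≢w
  vertex-injective (suc zero)       zero             eq = contradiction (sym eq) u≢v
  vertex-injective (suc zero)       (suc zero)       _  = refl
  vertex-injective (suc zero)       (suc (suc zero)) eq = contradiction eq v≢w
  vertex-injective (suc (suc zero)) zero             eq = contradiction (sym eq) u≢w
  vertex-injective (suc (suc zero)) (suc zero)       eq = contradiction (sym eq) v≢w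
  vertex-injective (suc (suc zero)) (suc (suc zero)) _  = refl

module PrimeGraph {n} (G : Graph n) (connected : Connected G) (prime : Prime G) where

  has-neighbour : ∀ {u v} → u ≢ v → ∃ λ w → w ∈ N G u
  has-neighbour {u} {v} u≢v with connected u v
  ... | ε                = contradiction refl u≢v
  ... | _◅_ {j = w} w∈ _ = w , w∈

  -- Primality with `∁ A` as the other side and both neighbourhoods unfolded into witnesses `d′` and
  -- `c′`.
  no-split : ∀ {A a a′ b b′} → a ∈ A → a′ ∈ A → a ≢ a′ → b ∉ A → b′ ∉ A → b ≢ b′ →
    ¬ (∀ {c c′ d d′} → c ∈ A → c′ ∈ A → d ∉ A → d′ ∉ A → c ∈ N G d′ → d ∈ N G c′ → d ∈ N G c)
  no-split {A} a∈ a′∈ a≢a′ b∉ b′∉ b≢b′ comp = prime (A , ∁ A , record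
    { cover    = p∪∁p≡⊤ A
    ; disjoint = λ (v , v∈) → let v∈A , v∈∁A = x∈p∩q⁻ A (∁ A) v∈ in x∈∁p⇒x∉p v∈∁A v∈A
    ; 1<∣A∣    = 1<∣p∣ a∈ a′∈ a≢a′
    ; 1<∣B∣    = 1<∣p∣ (x∉p⇒x∈∁p b∉) (x∉p⇒x∈∁p b′∉) b≢b′
    ; complete = λ { {c} (c∉∁A , d′ , d′∈∁A , c∈Nd′) (d∉A , c′ , c′∈A , d∈Nc′) →
        comp (decidable-stable (c ∈? A) (c∉∁A ∘ x∉p⇒x∈∁p)) c′∈A d∉A (x∈∁p⇒x∉p d′∈∁A) c∈Nd′ d∈Nc′ }
    })

  module _ {A a a′} (isModule : IsModule G A) (a∈A : a ∈ A) (a′∈A : a′ ∈ A) (a≢a′ : a ≢ a′) where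

    -- With two vertices outside, `A` and its complement would be a split: an outside vertex with a
    -- neighbour in `A` sees all of `A`.
    outside-module-unique : ∀ {b b′} → b ∉ A → b′ ∉ A → b ≡ b′
    outside-module-unique {b} {b′} b∉A b′∉A = decidable-stable (b ≟ᶠ b′) λ b≢b′ →
      no-split a∈A a′∈A a≢a′ b∉A b′∉A b≢b′ λ c∈A c′∈A d∉A _ _ d∈Nc′ →
        Graph.sym G (isModule c′∈A c∈A d∉A (Graph.sym G d∈Nc′))

    -- Connectivity gives `b` a neighbour. Everything but `b` lies in `A`, so the module property
    -- spreads this adjacency to all other vertices.
    outside-module-universal : ∀ {b} → b ∉ A → Universal G b
    outside-module-universal {b} b∉A v v≢b = isModule c∈A v∈A b∉A c∈Nb
      where
      c    = proj₁ (has-neighbour (v≢b ∘ sym))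
      c∈Nb = proj₂ (has-neighbour (v≢b ∘ sym))

      ∉A⇒≡b : ∀ {w} → w ∉ A → w ≡ b
      ∉A⇒≡b w∉A = outside-module-unique w∉A b∉A

      v∈A : v ∈ A
      v∈A = decidable-stable (v ∈? A) (v≢b ∘ ∉A⇒≡b)

      c∈A : c ∈ A
      c∈A = decidable-stable (c ∈? A) λ c∉A →
        Graph.irrefl G (subst (_∈ N G b) (∉A⇒≡b c∉A) c∈Nb)

  -- The pair `y`, `b` meets the rest only through the universal `b`, so a fourth vertex would
  -- create a split. Without one, the path `y`, `b`, `m` remains.
  leaf-at-universal : ∀ {b y m} → Universal G b → y ≢ b → (∀ {v} → v ∈ N G y → v ≡ b) →
    m ≢ y → m ≢ b → IsP₃ G
  leaf-at-universal {b} {y} {m} univ y≢b leaf m≢y m≢b =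
    three-vertices y≢b (m≢y ∘ sym) (m≢b ∘ sym) all ,
    y , b , m , m≢y ∘ sym , Graph.sym G (univ y y≢b) , univ m m≢b , λ m∈Ny → m≢b (leaf m∈Ny)
    where
    pair? : Decidable (λ v → v ≡ y ⊎ v ≡ b)
    pair? v = (v ≟ᶠ y) ⊎-dec (v ≟ᶠ b)

    A : Subset n
    A = collect pair?

    b∈A : b ∈ A
    b∈A = ∈-collect⁺ pair? (inj₂ refl)

    comp : ∀ {c c′ d d′} → c ∈ A → c′ ∈ A → d ∉ A → d′ ∉ A → c ∈ N G d′ → d ∈ N G c′ → d ∈ N G c
    comp {d = d} {d′} c∈A _ d∉A d′∉A c∈Nd′ _ with ∈-collect⁻ pair? c∈A
    -- The leaf `y` has no neighbour outside the pair.
    ... | inj₁ refl = contradiction (subst (_∈ A) (sym (leaf (Graph.sym G c∈Nd′))) b∈A) d′∉A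
    ... | inj₂ refl = univ d λ { refl → d∉A b∈A }

    all : ∀ t → t ≡ y ⊎ t ≡ b ⊎ t ≡ m
    all t with t ≟ᶠ y | t ≟ᶠ b | t ≟ᶠ m
    ... | yes t≡y | _       | _       = inj₁ t≡y
    ... | no _    | yes t≡b | _       = inj₂ (inj₁ t≡b)
    ... | no _    | no _    | yes t≡m = inj₂ (inj₂ t≡m)
    ... | no t≢y  | no t≢b  | no t≢m  = ⊥-elim
      (no-split (∈-collect⁺ pair? (inj₁ refl)) b∈A y≢b (outer t≢y t≢b) (outer m≢y m≢b) t≢m comp)
      where
      outer : ∀ {v} → v ≢ y → v ≢ b → v ∉ A
      outer v≢y v≢b v∈A with ∈-collect⁻ pair? v∈A
      ... | inj₁ v≡y = v≢y v≡y
      ... | inj₂ v≡b = v≢b v≡b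

  -- All neighbours of `y` are outside `A`, where only one vertex fits. That vertex is universal and
  -- `y` is a leaf at it.
  module-avoiding-neighbours : ∀ {A y m} → IsModule G A → y ∈ A → m ∈ A → m ≢ y →
    (∀ {v} → v ∈ A → v ∉ N G y) → IsP₃ G
  module-avoiding-neighbours {A} {y} {m} isModule y∈A m∈A m≢y avoids
    with has-neighbour (m≢y ∘ sym)
  ... | b , b∈Ny = leaf-at-universal
    (outside-module-universal isModule m∈A y∈A m≢y b∉A)
    (λ { refl → b∉A y∈A })
    (λ v∈Ny → outside-module-unique isModule m∈A y∈A m≢y (λ v∈A → avoids v∈A v∈Ny) b∉A)
    m≢y (λ { refl → b∉A m∈A })
    where
    b∉A : b ∉ A
    b∉A b∈A = avoids b∈A b∈Ny

-- From the ordering to modules of `G`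

lemma3p4 : (n : ℕ) (G : Graph n) (S : Subset n) →
    Connected G → Connected (G ⊕ S) →
    (σ : List (Fin (suc n))) → IsLBFS (G ⊕ S) σ → Last σ newVertex →
    Prime G → ¬ IsP₃ G →
    (y : Fin n) → Twins (G ⊕ S) newVertex (suc y) →
    Universal G y ⊎ Penultimate σ (suc y)
lemma3p4 n G S connected _ σ r (τ , refl) prime ¬P₃ y twins
  with penultimate⊎followed τ (lbfs-unique r) (before-last τ (lbfs-visits r ∈⊤) λ ())
... | inj₁ penultimate       = inj₂ penultimate
... | inj₂ (zero , x∈τ , _)  = contradiction (pos<pos-last τ (lbfs-unique r) x∈τ) (<-irrefl refl)
... | inj₂ (suc z , _ , y<z)  = inj₁ universal
  where
  H : Graph (suc n)
  H = G ⊕ S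

  p : Fin n → ℕ
  p v = pos σ (suc v)

  p-injective : ∀ {u v} → p u ≡ p v → u ≡ v
  p-injective = sucᶠ-injective ∘ lbfs-pos-injective r

  last : ∀ v → v ≢ zero → pos σ v < pos σ zero
  last v v≢x = pos<pos-last τ (lbfs-unique r) (before-last τ (lbfs-visits r ∈⊤) v≢x)

  open LastTwin H (pos σ) (lbfs-pos-injective r) (lbfs-fourPoint r) last twins
  open PrimeGraph G connected prime

  from : ∀ {u v} → suc u ∈ N H (suc v) → u ∈ N G v
  from (there u∈) = u∈

  A₀? : Decidable (λ v → p y ≤ p v)
  A₀? v = p y ≤? p v

  -- `y` itself qualifies, not being its own neighbour.
  A₁? : Decidable (λ v → p y ≤ p v × v ∉ N G y)
  A₁? v = A₀? v ×-dec ¬? (v ∈? N G y)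

  y-or-after : ∀ {v} → p y ≤ p v → v ≡ y ⊎ p y < p v
  y-or-after le with m≤n⇒m<n∨m≡n le
  ... | inj₁ lt = inj₂ lt
  ... | inj₂ eq = inj₁ (p-injective (sym eq))

  -- The comparison passes through `y`, since `uniform` relates later vertices only to `y`.
  before⇒uniform : ∀ {b a a′} → p b < p y → p y ≤ p a → p y ≤ p a′ → a ∈ N G b → a′ ∈ N G b
  before⇒uniform {b} b<y y≤a y≤a′ a∈Nb = out (y-or-after y≤a′) (into (y-or-after y≤a) a∈Nb)
    where
    into : ∀ {a} → a ≡ y ⊎ p y < p a → a ∈ N G b → y ∈ N G b
    into (inj₁ refl) a∈ = a∈
    into (inj₂ y<a)  a∈ = from (before-z⇒y b<y y<a (λ ()) (there a∈))

    out : ∀ {a} → a ≡ y ⊎ p y < p a → y ∈ N G b → a ∈ N G b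
    out (inj₁ refl) y∈ = y∈
    out (inj₂ y<a)  y∈ = from (before-y⇒z b<y y<a (λ ()) (there y∈))

  A₀-module : IsModule G (collect A₀?)
  A₀-module a∈ a′∈ b∉ = before⇒uniform (≰⇒> (b∉ ∘ ∈-collect⁺ A₀?)) (∈-collect⁻ A₀? a∈) (∈-collect⁻ A₀? a′∈)

  A₁-module : IsModule G (collect A₁?)
  A₁-module {a} {a′} {b} a∈ a′∈ b∉ a∈Nb with ∈-collect⁻ A₁? a∈ | ∈-collect⁻ A₁? a′∈ | A₀? b
  ... | y≤a , _ | y≤a′ , a′∉Ny | no y≰b  = before⇒uniform (≰⇒> y≰b) y≤a y≤a′ a∈Nb
  -- Being outside but not before `y`, `b` is a neighbour of `y`; `after-complete` then joins it to
  -- the rest of the module.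
  ... | _       | y≤a′ , a′∉Ny | yes y≤b = lem (y-or-after y≤b) (y-or-after y≤a′)
    where
    b∈Ny : b ∈ N G y
    b∈Ny = decidable-stable (b ∈? N G y) λ b∉Ny → b∉ (∈-collect⁺ A₁? (y≤b , b∉Ny))

    lem : b ≡ y ⊎ p y < p b → a′ ≡ y ⊎ p y < p a′ → a′ ∈ N G b
    lem (inj₁ refl) _           = contradiction b∈Ny (Graph.irrefl G)
    lem (inj₂ _)    (inj₁ refl) = Graph.sym G b∈Ny
    lem (inj₂ y<b)  (inj₂ y<a′) =
      from (after-complete y<a′ (λ ()) (a′∉Ny ∘ from) y<b (λ ()) (there b∈Ny))

  universal : Universal G y
  universal v v≢y with A₀? v
  -- `v` lies outside a module containing `y` and `z`, so it is universal and in particular adjacent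
  -- to `y`.
  ... | no y≰v = Graph.sym G (outside-module-universal A₀-module
    (∈-collect⁺ A₀? (<⇒≤ y<z)) (∈-collect⁺ A₀? ≤-refl) (λ { refl → <-irrefl refl y<z })
    (y≰v ∘ ∈-collect⁻ A₀?) y (v≢y ∘ sym))
  -- A non-neighbour `v` would join `y` in a module free of neighbours of `y`, forcing the excluded
  -- path.
  ... | yes y≤v = decidable-stable (v ∈? N G y) λ v∉Ny → ¬P₃
    (module-avoiding-neighbours A₁-module
      (∈-collect⁺ A₁? (≤-refl , Graph.irrefl G)) (∈-collect⁺ A₁? (y≤v , v∉Ny)) v≢y
      (proj₂ ∘ ∈-collect⁻ A₁?))
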